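{- Let $\mathrm{Prop}$ be a finite set of propositional variables. A first-order formula $\alpha(x)$ with one free variable $x$, in the signature with one binary relation symbol $R$ and one unary relation symbol for each $p\in\mathrm{Prop}$, is preserved under weak simulations if and only if it is equivalent to the standard translation of a formula in $\mathcal{L}_{\Box,\Diamond,\wedge,\vee}[\mathrm{Prop}]\cup\{\top,\bot\}$.
   Context: $\mathcal{L}_{\Box,\Diamond,\wedge,\vee}[\mathrm{Prop}]$ is the set of modal formulas generated from the variables in $\mathrm{Prop}$ using only $\Box,\Diamond$ and binary $\wedge,\vee$. A Kripke model over $\mathrm{Prop}$ is $M=(dom(M),R,v)$ with $R\subseteq dom(M)\times dom(M)$ and $v:dom(M)\to\mathcal{P}(\mathrm{Prop})$ (models may be infinite); a pointed model is a pair $(M,s)$ with $s\in dom(M)$. A Kripke model is identified with the first-order structure in which $R$ is interpreted as the accessibility relation and the unary symbol for $p$ holds at $t$ iff $p\in v(t)$. The standard translation $ST_x(\varphi)$ of a modal formula $\varphi$ is the usual first-order formula in one free variable $x$ with $M,s\models\varphi$ iff $M\models ST_x(\varphi)[s]$. $\underline{\leftrightarrow}$ denotes (standard) bisimilarity of pointed models. The empty loopstate $\circlearrowright_{\emptyset}$ is the pointed model consisting of a single reflexive point at which no $p\in\mathrm{Prop}$ is true; the full loopstate $\circlearrowright_{\mathrm{Prop}}$ is the pointed model consisting of a single reflexive point at which every $p\in\mathrm{Prop}$ is true. A weak simulation from $(M,s)$ to $(M',s')$ is a relation $Z\subseteq dom(M)\times dom(M')$ with $(s,s')\in Z$ such that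 for all $(t,t')\in Z$: (atom) $v^M(t)\subseteq v^{M'}(t')$; (forth') if $R^Mtu$, then either $M,u\mathrel{\underline{\leftrightarrow}}\circlearrowright_{\emptyset}$ or there is $u'$ with $R^{M'}t'u'$ and $(u,u')\in Z$; (back') if $R^{M'}t'u'$, then either $M',u'\mathrel{\underline{\leftrightarrow}}\circlearrowright_{\mathrm{Prop}}$ or there is $u$ with $R^Mtu$ and $(u,u')\in Z$. $\alpha(x)$ is preserved under weak simulations if, whenever there is a weak simulation from $(M,s)$ to $(M',s')$ and $M\models\alpha[s]$, then $M'\models\alpha[s']$. -}

module Defs where

open import Data.Empty using (⊥)
open import Data.Fin.Base using (Fin; zero; suc)
open import Data.Nat.Base using (ℕ; suc)
open import Data.Product.Base using (Σ; ∃-syntax; _×_; _,_)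
open import Data.Product.Function.NonDependent.Propositional using (_×-⇔_)
open import Data.Sum.Base using (_⊎_)
open import Data.Sum.Function.Propositional using (_⊎-⇔_)
open import Data.Unit.Base using (⊤; tt)
open import Data.Vec.Base using (Vec; []; _∷_; lookup)
open import Function.Bundles using (_⇔_; mk⇔; module Equivalence)
open import Function.Properties.Equivalence using (⇔-isEquivalence)
open import Level using (0ℓ) renaming (suc to lsuc)
open import Relation.Binary.Core using (REL; Rel)
open import Relation.Binary.PropositionalEquality.Core using (_≡_; refl)
open import Relation.Binary.Structures using (IsEquivalence)
open import Relation.Nullary.Negation.Core using (¬_)
open import Relation.Unary using (Pred; _⊆_; _≐_; ∅; U)

-- Throughout, V is the set Prop of propositional variables.

record KripkeModel (V : Set) : Set₁ where
  field
    dom : Set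
    R   : Rel dom 0ℓ
    v   : dom → Pred V 0ℓ

open KripkeModel public

PointedModel : Set → Set₁
PointedModel V = Σ (KripkeModel V) dom

module _ {V : Set} where

  record IsBisimulation (M M′ : KripkeModel V) (Z : REL (dom M) (dom M′) 0ℓ) : Set where
    field
      atom  : ∀ {t t′} → Z t t′ → v M t ≐ v M′ t′
      forth : ∀ {t t′ u} → Z t t′ → R M t u → ∃[ u′ ] R M′ t′ u′ × Z u u′
      back  : ∀ {t t′ u′} → Z t t′ → R M′ t′ u′ → ∃[ u ] R M t u × Z u u′

  infix 4 _↔̲_

  _↔̲_ : PointedModel V → PointedModel V → Set₁
  (M , s) ↔̲ (M′ , s′) = ∃[ Z ] IsBisimulation M M′ Z × Z s s′

  loopstate : Pred V 0ℓ → PointedModel V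
  loopstate X = record { dom = ⊤ ; R = λ _ _ → ⊤ ; v = λ _ → X } , tt

  emptyLoopstate fullLoopstate : PointedModel V
  emptyLoopstate = loopstate ∅
  fullLoopstate  = loopstate U

  record IsWeakSimulation (M M′ : KripkeModel V) (Z : REL (dom M) (dom M′) 0ℓ) : Set₁ where
    field
      atom   : ∀ {t t′} → Z t t′ → v M t ⊆ v M′ t′
      forth′ : ∀ {t t′ u} → Z t t′ → R M t u →
               (M , u) ↔̲ emptyLoopstate ⊎ (∃[ u′ ] R M′ t′ u′ × Z u u′)
      back′  : ∀ {t t′ u′} → Z t t′ → R M′ t′ u′ →
               (M′ , u′) ↔̲ fullLoopstate ⊎ (∃[ u ] R M t u × Z u u′)

  WeaklySimulates : PointedModel V → PointedModel V → Set₁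
  WeaklySimulates (M , s) (M′ , s′) = ∃[ Z ] IsWeakSimulation M M′ Z × Z s s′

-- First-order formulas with equality whose free variables are de Bruijn
-- indices in Fin k; a quantifier binds index zero.

data FO (V : Set) (k : ℕ) : Set where
  rel           : Fin k → Fin k → FO V k
  prd           : V → Fin k → FO V k
  eq            : Fin k → Fin k → FO V k
  ⊤ᶠ ⊥ᶠ         : FO V k
  ¬ᶠ_           : FO V k → FO V k
  _∧ᶠ_ _∨ᶠ_ _⇒ᶠ_ : FO V k → FO V k → FO V k
  ∀ᶠ_ ∃ᶠ_       : FO V (suc k) → FO V k

infix  8 ¬ᶠ_ ∀ᶠ_ ∃ᶠ_
infixr 7 _∧ᶠ_
infixr 6 _∨ᶠ_
infixr 5 _⇒ᶠ_

infix 4 _⊨_[_]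

_⊨_[_] : ∀ {V k} (M : KripkeModel V) → FO V k → Vec (dom M) k → Set
M ⊨ rel x y  [ ρ ] = R M (lookup ρ x) (lookup ρ y)
M ⊨ prd p x  [ ρ ] = v M (lookup ρ x) p
M ⊨ eq x y   [ ρ ] = lookup ρ x ≡ lookup ρ y
M ⊨ ⊤ᶠ       [ ρ ] = ⊤
M ⊨ ⊥ᶠ       [ ρ ] = ⊥
M ⊨ ¬ᶠ α     [ ρ ] = ¬ (M ⊨ α [ ρ ])
M ⊨ α ∧ᶠ β   [ ρ ] = (M ⊨ α [ ρ ]) × (M ⊨ β [ ρ ])
M ⊨ α ∨ᶠ β   [ ρ ] = (M ⊨ α [ ρ ]) ⊎ (M ⊨ β [ ρ ])
M ⊨ α ⇒ᶠ β   [ ρ ] = M ⊨ α [ ρ ] → M ⊨ β [ ρ ]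
M ⊨ ∀ᶠ α     [ ρ ] = (t : dom M) → M ⊨ α [ t ∷ ρ ]
M ⊨ ∃ᶠ α     [ ρ ] = ∃[ t ] M ⊨ α [ t ∷ ρ ]

infix 4 _≡ᶠ_

_≡ᶠ_ : ∀ {V k} → FO V k → FO V k → Set₁
_≡ᶠ_ {V} {k} α β = (M : KripkeModel V) (ρ : Vec (dom M) k) → M ⊨ α [ ρ ] ⇔ M ⊨ β [ ρ ]

PreservedUnderWeakSimulations : ∀ {V} → FO V 1 → Set₁
PreservedUnderWeakSimulations {V} α =
  (M M′ : KripkeModel V) (s : dom M) (s′ : dom M′) →
  WeaklySimulates (M , s) (M′ , s′) → M ⊨ α [ s ∷ [] ] → M′ ⊨ α [ s′ ∷ [] ]

data Modal (V : Set) : Set where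
  var       : V → Modal V
  ⊤ᵐ ⊥ᵐ     : Modal V
  ¬ᵐ_       : Modal V → Modal V
  _∧ᵐ_ _∨ᵐ_ : Modal V → Modal V → Modal V
  □_ ◇_     : Modal V → Modal V

infix  8 ¬ᵐ_ □_ ◇_
infixr 7 _∧ᵐ_
infixr 6 _∨ᵐ_

infix 4 _,_⊩_

_,_⊩_ : ∀ {V} (M : KripkeModel V) → dom M → Modal V → Set
M , s ⊩ var p  = v M s p
M , s ⊩ ⊤ᵐ     = ⊤
M , s ⊩ ⊥ᵐ     = ⊥
M , s ⊩ ¬ᵐ φ   = ¬ (M , s ⊩ φ)
M , s ⊩ φ ∧ᵐ ψ = (M , s ⊩ φ) × (M , s ⊩ ψ)
M , s ⊩ φ ∨ᵐ ψ = (M , s ⊩ φ) ⊎ (M , s ⊩ ψ)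
M , s ⊩ □ φ    = ∀ t → R M s t → M , t ⊩ φ
M , s ⊩ ◇ φ    = ∃[ t ] R M s t × (M , t ⊩ φ)

ST : ∀ {V k} → Fin k → Modal V → FO V k
ST x (var p)  = prd p x
ST x ⊤ᵐ       = ⊤ᶠ
ST x ⊥ᵐ       = ⊥ᶠ
ST x (¬ᵐ φ)   = ¬ᶠ ST x φ
ST x (φ ∧ᵐ ψ) = ST x φ ∧ᶠ ST x ψ
ST x (φ ∨ᵐ ψ) = ST x φ ∨ᶠ ST x ψ
ST x (□ φ)    = ∀ᶠ (rel (suc x) zero ⇒ᶠ ST zero φ)
ST x (◇ φ)    = ∃ᶠ (rel (suc x) zero ∧ᶠ ST zero φ)

ST-correct : ∀ {V k} (M : KripkeModel V) (ρ : Vec (dom M) k) (x : Fin k) (φ : Modal V) →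
             M , lookup ρ x ⊩ φ ⇔ M ⊨ ST x φ [ ρ ]
ST-correct M ρ x (var p)  = IsEquivalence.refl ⇔-isEquivalence
ST-correct M ρ x ⊤ᵐ       = IsEquivalence.refl ⇔-isEquivalence
ST-correct M ρ x ⊥ᵐ       = IsEquivalence.refl ⇔-isEquivalence
ST-correct M ρ x (¬ᵐ φ)   =
  let open Equivalence (ST-correct M ρ x φ) in
  mk⇔ (λ ¬φ a → ¬φ (from a)) (λ ¬a h → ¬a (to h))
ST-correct M ρ x (φ ∧ᵐ ψ) = ST-correct M ρ x φ ×-⇔ ST-correct M ρ x ψ
ST-correct M ρ x (φ ∨ᵐ ψ) = ST-correct M ρ x φ ⊎-⇔ ST-correct M ρ x ψ
ST-correct M ρ x (□ φ)    =
  mk⇔ (λ h t r → Equivalence.to   (ST-correct M (t ∷ ρ) zero φ) (h t r))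
      (λ h t r → Equivalence.from (ST-correct M (t ∷ ρ) zero φ) (h t r))
ST-correct M ρ x (◇ φ)    =
  mk⇔ (λ (t , r , h) → t , r , Equivalence.to   (ST-correct M (t ∷ ρ) zero φ) h)
      (λ (t , r , h) → t , r , Equivalence.from (ST-correct M (t ∷ ρ) zero φ) h)

-- The constants ⊤ and ⊥ do not belong to this fragment, so for instance
-- □ ⊥ᵐ is excluded.

data L□◇∧∨ {V : Set} : Modal V → Set where
  var  : ∀ p → L□◇∧∨ (var p)
  _∧ᵐ_ : ∀ {φ ψ} → L□◇∧∨ φ → L□◇∧∨ ψ → L□◇∧∨ (φ ∧ᵐ ψ)
  _∨ᵐ_ : ∀ {φ ψ} → L□◇∧∨ φ → L□◇∧∨ ψ → L□◇∧∨ (φ ∨ᵐ ψ)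
  □_   : ∀ {φ} → L□◇∧∨ φ → L□◇∧∨ (□ φ)
  ◇_   : ∀ {φ} → L□◇∧∨ φ → L□◇∧∨ (◇ φ)

L□◇∧∨∪⊤⊥ : ∀ {V} → Modal V → Set
L□◇∧∨∪⊤⊥ φ = L□◇∧∨ φ ⊎ φ ≡ ⊤ᵐ ⊎ φ ≡ ⊥ᵐ

{-# OPTIONS --safe #-}
module Submission where

-- A formula preserved under weak simulations is in particular bisimulation
-- invariant, hence local: M and the truncation N of its unravelling at depth
-- ℓ = radius α can be compared inside one and the same model, countably many
-- disjoint copies of both, where the duplicator wins the Ehrenfeucht–Fraïssé game
-- by following a local isomorphism near the points already played and answering
-- all other moves in a fresh copy. What is attached to the leaves of N is therefore
-- irrelevant for α. With empty loopstates below the leaves of M and full ones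
-- below those of M′, a point falsifying (satisfying) all fragment formulas of the
-- remaining depth becomes bisimilar to the empty (full) loopstate, so inclusion of
-- the fragment types of depth ℓ yields a weak simulation between the truncations.
-- Hence α is the disjunction of the finitely many types of depth ℓ of its models.
-- For empty Prop there is no formula in the fragment, but then the loopstate
-- simulates, and is simulated by, every pointed model.

open import Defs
open import Axiom.ExcludedMiddle using (ExcludedMiddle)
open import Data.Empty using (⊥-elim)
open import Data.Fin.Base using (Fin; zero; suc)
open import Data.List.Base using (List; []; _∷_; _++_; map; concatMap; length; allFin)
open import Data.List.Membership.Propositional using (_∈_; find; lose)
open import Data.List.Membership.Propositional.Properties
  using (∈-map⁺; ∈-++⁺ˡ; ∈-++⁺ʳ; ∈-concatMap⁺; ∈-allFin)
open import Data.List.Relation.Unary.All as All using (All; []; _∷_)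
open import Data.List.Relation.Unary.Any as Any using (Any; here; there)
open import Data.Maybe.Base using (Maybe; just; nothing)
open import Data.Nat.Base
open import Data.Nat.Properties
open import Data.Product.Base using (∃-syntax; _×_; _,_; proj₁; proj₂; ∃)
open import Data.Sum.Base using (_⊎_; inj₁; inj₂)
open import Data.Sum.Relation.Binary.Pointwise using (Pointwise; inj₁; inj₂)
open import Data.Unit.Base using (⊤; tt)
open import Data.Vec.Base using (Vec; []; _∷_; lookup)
open import Function.Base using (flip; _∘_; id)
open import Function.Bundles using (_⇔_; _↔_; mk⇔; module Equivalence; module Inverse)
open import Level using (0ℓ; Lift; lift; lower) renaming (suc to lsuc)
open import Relation.Binary.Construct.Closure.Symmetric using (SymClosure; fwd; bwd; symmetric)
open import Relation.Binary.Core using (Rel; REL)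
open import Relation.Binary.PropositionalEquality using (_≡_; _≢_; refl; sym; trans; subst)
open import Relation.Nullary.Decidable.Core using (yes; no; map′; decidable-stable)
open import Relation.Nullary.Negation.Core using (¬_; contradiction)
open import Relation.Unary using (Pred; _⊆_; _≐_; ∅; U)

-- Local isomorphisms

private variable
  V : Set

Adjacent : (M : KripkeModel V) → Rel (dom M) 0ℓ
Adjacent M = SymClosure (R M)

-- F i x y: the local isomorphism matches x with y and is still defined on all
-- points that can be reached from x, or from y, in i undirected steps.
record IsLocalHom (M : KripkeModel V) (F : ℕ → Rel (dom M) 0ℓ) : Set where
  field
    weaken     : ∀ {i x y} → F (suc i) x y → F i x y
    functional : ∀ {x y x′ y′} → F 0 x y → F 0 x′ y′ → x ≡ x′ → y ≡ y′
    atom       : ∀ {x y} → F 0 x y → v M x ⊆ v M y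
    preserves  : ∀ {x y x′ y′} → F 0 x y → F 0 x′ y′ → R M x x′ → R M y y′
    extends    : ∀ {i x y u} → F (suc i) x y → Adjacent M x u → ∃ (F i u)

  weaken-≤ : ∀ {i j x y} → i ≤ j → F j x y → F i x y
  weaken-≤ i≤j = go (≤⇒≤′ i≤j)
    where
    go : ∀ {i j x y} → i ≤′ j → F j x y → F i x y
    go ≤′-refl       f = f
    go (≤′-step i≤j) f = go i≤j (weaken f)

transport : {M : KripkeModel V} {F G : ℕ → Rel (dom M) 0ℓ} →
            (∀ {i x y} → F i x y → G i x y) → (∀ {i x y} → G i x y → F i x y) →
            IsLocalHom M F → IsLocalHom M G
transport to from hom = record
  { weaken     = λ g → to (weaken (from g))
  ; functional = λ g g′ → functional (from g) (from g′)
  ; atom       = λ g → atom (from g)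
  ; preserves  = λ g g′ → preserves (from g) (from g′)
  ; extends    = λ g a → let w , f = extends (from g) a in w , to f
  }
  where open IsLocalHom hom

-- A local isomorphism has a `bound` on the copies it touches, so with one copy per number a fresh
-- one is always available.
copies : KripkeModel V → KripkeModel V
dom (copies M) = dom M × ℕ
R (copies M) (x , i) (y , j) = i ≡ j × R M x y
v (copies M) (x , i) = v M x

module _ (M : KripkeModel V) (d : ℕ) (z : dom M) where

  -- Near i x: x can be reached from z in at most d ∸ i undirected steps.
  data Near : ℕ → dom M → Set where
    here : Near d z
    wait : ∀ {i x} → Near (suc i) x → Near i x
    step : ∀ {i x y} → Near (suc i) x → Adjacent M x y → Near i y

  near⇒≤ : ∀ {i x} → Near i x → i ≤ d
  near⇒≤ here       = ≤-refl
  near⇒≤ (wait p)   = <⇒≤ (near⇒≤ p)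
  near⇒≤ (step p _) = <⇒≤ (near⇒≤ p)

module _ {M : KripkeModel V} where

  adjacent-copy : ∀ {x u c} → Adjacent M x u → Adjacent (copies M) (x , c) (u , c)
  adjacent-copy (fwd r) = fwd (refl , r)
  adjacent-copy (bwd r) = bwd (refl , r)

  copy-adjacent : ∀ {x u c e} → Adjacent (copies M) (x , c) (u , e) → e ≡ c × Adjacent M x u
  copy-adjacent (fwd (refl , r)) = refl , fwd r
  copy-adjacent (bwd (refl , r)) = refl , bwd r

  module _ (F : ℕ → Rel (dom M × ℕ) 0ℓ) (d : ℕ) (z : dom M) where

    -- With slack suc (d + d) no old point equals or is adjacent to a new one, unless F
    -- already matches z with slack d.
    data Extend (c m : ℕ) : ℕ → Rel (dom M × ℕ) 0ℓ where
      old : ∀ {i x y} → F (i + suc (d + d)) x y → Extend c m i x y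
      new : ∀ {i u} → Near M d z i u → Extend c m i (u , c) (u , m)

    Separated : ℕ → Set
    Separated c = ∀ {x y u} → F (suc (d + d)) x y → Near M d z 0 u →
                  x ≢ (u , c) × ¬ Adjacent (copies M) x (u , c)

    module _ (hom : IsLocalHom (copies M) F) where
      open IsLocalHom hom

      -- Walk back along the path from `z` to `x`. Each edge costs one unit of slack, at most
      -- `d ∸ i` edges remain, and `j` covers them, so slack `d` survives at `z`.
      approach : ∀ {i j x y c} → Near M d z i x → d ≤ i + j → F (j + d) (x , c) y → ∃ (F d (z , c))
      approach {j = j} here d≤ f = _ , weaken-≤ (m≤n+m d j) f
      approach {i} {j} (wait p) d≤ f = approach p (m≤n⇒m≤1+n d≤) f
      approach {i} {zero} (step p _) d≤ f =
        contradiction (≤-trans (near⇒≤ M d z p) (subst (d ≤_) (+-identityʳ i) d≤)) 1+n≰n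
      approach {i} {suc j} (step p a) d≤ f =
        let w , g = extends f (adjacent-copy (symmetric (R M) a))
        in approach p (subst (d ≤_) (+-suc i j) d≤) g

      -- An old point equal or adjacent to a new one could be walked back to `z`. One unit of slack
      -- pays for the adjacency, `d` for the walk, and the last `d` would make `z` matched.
      unmatched⇒separated : ∀ {c} → ¬ ∃ (F d (z , c)) → Separated c
      unmatched⇒separated ¬match f p =
        (λ where refl → ¬match (approach p ≤-refl (weaken f))) ,
        (λ a → let _ , g = extends f a in ¬match (approach p ≤-refl g))

      -- Separation on the source side rules out the mixed old and new cases. The target side is
      -- handled by the same lemma for the flipped relation.
      extend-isLocalHom : ∀ {c m} → Separated c → IsLocalHom (copies M) (Extend c m)
      extend-isLocalHom {c} {m} separated = record
        { weaken     = λ { (old f) → old (weaken f) ; (new p) → new (wait p) }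
        ; functional = functional′
        ; atom       = λ { (old f) → atom (weaken-≤ z≤n f) ; (new _) → id }
        ; preserves  = preserves′
        ; extends    = extends′
        }
        where
        functional′ : ∀ {x y x′ y′} → Extend c m 0 x y → Extend c m 0 x′ y′ → x ≡ x′ → y ≡ y′
        functional′ (old f) (old g) x≡x′ = functional (weaken-≤ z≤n f) (weaken-≤ z≤n g) x≡x′
        functional′ (old f) (new p) x≡x′ = contradiction x≡x′ (proj₁ (separated f p))
        functional′ (new p) (old f) x≡x′ = contradiction (sym x≡x′) (proj₁ (separated f p))
        functional′ (new p) (new q) refl = refl

        preserves′ : ∀ {x y x′ y′} → Extend c m 0 x y → Extend c m 0 x′ y′ →
                     R (copies M) x x′ → R (copies M) y y′
        preserves′ (old f) (old g) r       = preserves (weaken-≤ z≤n f) (weaken-≤ z≤n g) r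
        preserves′ (old f) (new p) r       = contradiction (fwd r) (proj₂ (separated f p))
        preserves′ (new p) (old f) r       = contradiction (bwd r) (proj₂ (separated f p))
        preserves′ (new p) (new q) (_ , r) = refl , r

        extends′ : ∀ {i x y u} → Extend c m (suc i) x y → Adjacent (copies M) x u →
                   ∃ (Extend c m i u)
        extends′ (old f) a = let _ , g = extends f a in _ , old g
        extends′ (new p) a with refl , b ← copy-adjacent a = _ , new (step p b)

record LocalIso (M : KripkeModel V) (F : ℕ → Rel (dom M × ℕ) 0ℓ) : Set where
  field
    hom     : IsLocalHom (copies M) F
    hom⁻¹   : IsLocalHom (copies M) (λ i → flip (F i))
    bound   : ℕ
    bounded : ∀ {x y} → F 0 x y → proj₂ x < bound × proj₂ y < bound

module _ {M : KripkeModel V} where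

  inverse : ∀ {F} → LocalIso M F → LocalIso M (λ i → flip (F i))
  inverse iso = record
    { hom = hom⁻¹ ; hom⁻¹ = hom ; bound = bound ; bounded = λ f → proj₂ (bounded f) , proj₁ (bounded f) }
    where open LocalIso iso

  extend-flip : ∀ {F : ℕ → Rel (dom M × ℕ) 0ℓ} {d z c m i x y} →
                Extend {M = M} (λ j → flip (F j)) d z m c i x y → Extend {M = M} F d z c m i y x
  extend-flip (old f) = old f
  extend-flip (new p) = new p

  -- A point out of reach of F is matched with its counterpart in a fresh copy.
  extend-iso : ∀ {F d z c} (iso : LocalIso M F) → ¬ ∃ (F d (z , c)) →
               LocalIso M (Extend F d z c (LocalIso.bound iso))
  extend-iso {F} {d} {z} {c} iso ¬match = record
    { hom     = extend-isLocalHom F d z hom (unmatched⇒separated F d z hom ¬match)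
    ; hom⁻¹   = transport {F = Extend (λ j → flip (F j)) d z bound c} extend-flip extend-flip
                  (extend-isLocalHom _ d z hom⁻¹ fresh)
    ; bound   = suc (c ⊔ bound)
    ; bounded = bounded′
    }
    where
    open LocalIso iso

    in-bound : ∀ {j x y} → F j x y → proj₂ x < bound × proj₂ y < bound
    in-bound f = bounded (IsLocalHom.weaken-≤ hom z≤n f)

    -- Adjacent points share a copy, and `F` only reaches copies below `bound`.
    fresh : Separated (λ j → flip (F j)) d z bound
    fresh f p with _ , y<bound ← in-bound f =
      (λ where refl → n≮n _ y<bound) ,
      (λ a → n≮n _ (subst (_< bound) (sym (proj₁ (copy-adjacent {M = M} a))) y<bound))

    bounded′ : ∀ {x y} → Extend F d z c bound 0 x y → proj₂ x < suc (c ⊔ bound) × proj₂ y < suc (c ⊔ bound)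
    bounded′ (old f) with x< , y< ← in-bound f =
      m≤n⇒m≤1+n (≤-trans x< (m≤n⊔m c bound)) , m≤n⇒m≤1+n (≤-trans y< (m≤n⊔m c bound))
    bounded′ (new _) = s≤s (m≤m⊔n c bound) , s≤s (m≤n⊔m c bound)

-- The Ehrenfeucht-Fraïssé game on copies

Matched : ∀ {A : Set} {k} → (ℕ → Rel A 0ℓ) → ℕ → Rel (Vec A k) 0ℓ
Matched F d ρ ρ′ = ∀ x → F d (lookup ρ x) (lookup ρ′ x)

-- A quantifier turns r into r + (2r + 1): `Extend` spends 2r + 1 on keeping a new point apart from
-- the old ones, and r must remain for the body.
radius : ∀ {k} → FO V k → ℕ
radius (rel _ _) = 0
radius (prd _ _) = 0
radius (eq _ _)  = 0
radius ⊤ᶠ        = 0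
radius ⊥ᶠ        = 0
radius (¬ᶠ α)    = radius α
radius (α ∧ᶠ β)  = radius α ⊔ radius β
radius (α ∨ᶠ β)  = radius α ⊔ radius β
radius (α ⇒ᶠ β)  = radius α ⊔ radius β
radius (∀ᶠ α)    = radius α + suc (radius α + radius α)
radius (∃ᶠ α)    = radius α + suc (radius α + radius α)

module _ (em : ExcludedMiddle (lsuc 0ℓ)) where

  em₀ : ExcludedMiddle 0ℓ
  em₀ = map′ lower lift em

  module _ {M : KripkeModel V} where

    respond : ∀ {k F d} {ρ ρ′ : Vec (dom M × ℕ) k} → LocalIso M F →
              Matched F (d + suc (d + d)) ρ ρ′ → ∀ t →
              ∃[ t′ ] ∃[ G ] LocalIso M G × Matched G d (t ∷ ρ) (t′ ∷ ρ′)
    respond {F = F} {d} iso match (z , c) with em₀ {∃ (F d (z , c))}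
    ... | yes (t′ , f) = t′ , F , iso , λ where
      zero    → f
      (suc x) → IsLocalHom.weaken-≤ (LocalIso.hom iso) (m≤m+n d _) (match x)
    ... | no ¬match = (z , LocalIso.bound iso) , _ , extend-iso iso ¬match , λ where
      zero    → new here
      (suc x) → old (match x)

    -- Negative positions run on the inverse isomorphism. At `∀ᶠ` the spoiler moves on the side of
    -- `ρ′`, so the answer is computed for the inverse as well.
    transfer : ∀ {k F} (α : FO V k) {ρ ρ′ : Vec (dom M × ℕ) k} → LocalIso M F →
               Matched F (radius α) ρ ρ′ → copies M ⊨ α [ ρ ] → copies M ⊨ α [ ρ′ ]
    transfer (rel x y) iso match h = IsLocalHom.preserves (LocalIso.hom iso) (match x) (match y) h
    transfer (prd p x) iso match h = IsLocalHom.atom (LocalIso.hom iso) (match x) h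
    transfer (eq x y)  iso match h = IsLocalHom.functional (LocalIso.hom iso) (match x) (match y) h
    transfer ⊤ᶠ iso match h = h
    transfer ⊥ᶠ iso match h = h
    transfer (¬ᶠ α) iso match h = λ a → h (transfer α (inverse iso) match a)
    transfer (α ∧ᶠ β) iso match (a , b) =
      transfer α iso (λ x → weaken-≤ (m≤m⊔n _ _) (match x)) a ,
      transfer β iso (λ x → weaken-≤ (m≤n⊔m (radius α) _) (match x)) b
      where open IsLocalHom (LocalIso.hom iso)
    transfer (α ∨ᶠ β) iso match (inj₁ a) =
      inj₁ (transfer α iso (λ x → weaken-≤ (m≤m⊔n _ _) (match x)) a)
      where open IsLocalHom (LocalIso.hom iso)
    transfer (α ∨ᶠ β) iso match (inj₂ b) =
      inj₂ (transfer β iso (λ x → weaken-≤ (m≤n⊔m (radius α) _) (match x)) b)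
      where open IsLocalHom (LocalIso.hom iso)
    transfer (α ⇒ᶠ β) iso match h a =
      transfer β iso (λ x → weaken-≤ (m≤n⊔m (radius α) _) (match x))
        (h (transfer α (inverse iso) (λ x → weaken-≤ (m≤m⊔n _ _) (match x)) a))
      where open IsLocalHom (LocalIso.hom iso)
    transfer (∀ᶠ α) iso match h t′ =
      let t , _ , iso′ , match′ = respond (inverse iso) match t′
      in transfer α (inverse iso′) match′ (h t)
    transfer (∃ᶠ α) iso match (t , a) =
      let t′ , _ , iso′ , match′ = respond iso match t
      in t′ , transfer α iso′ match′ a

-- Bisimulation invariance and locality

satisfies : FO V 1 → PointedModel V → Set
satisfies α (M , s) = M ⊨ α [ s ∷ [] ]

↔̲-sym : {X Y : PointedModel V} → X ↔̲ Y → Y ↔̲ X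
↔̲-sym (Z , bisim , z) = flip Z , record
  { atom  = λ z → proj₂ (atom z) , proj₁ (atom z)
  ; forth = back
  ; back  = forth
  } , z
  where open IsBisimulation bisim

↔̲⇒weaklySimulates : {X Y : PointedModel V} → X ↔̲ Y → WeaklySimulates X Y
↔̲⇒weaklySimulates (Z , bisim , z) = Z , record
  { atom   = λ z → proj₁ (atom z)
  ; forth′ = λ z r → inj₂ (forth z r)
  ; back′  = λ z r → inj₂ (back z r)
  } , z
  where open IsBisimulation bisim

infixr 6 _⊎ᴷ_

_⊎ᴷ_ : KripkeModel V → KripkeModel V → KripkeModel V
dom (M ⊎ᴷ N) = dom M ⊎ dom N
R (M ⊎ᴷ N)   = Pointwise (R M) (R N)
v (M ⊎ᴷ N) (inj₁ s) = v M s
v (M ⊎ᴷ N) (inj₂ t) = v N t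

↔̲-inj₁ : (M N : KripkeModel V) (s : dom M) → (M , s) ↔̲ (M ⊎ᴷ N , inj₁ s)
↔̲-inj₁ M N s = (λ t t′ → inj₁ t ≡ t′) , record
  { atom  = λ { refl → id , id }
  ; forth = λ { refl r → _ , inj₁ r , refl }
  ; back  = λ { refl (inj₁ r) → _ , r , refl }
  } , refl

↔̲-inj₂ : (M N : KripkeModel V) (s : dom N) → (N , s) ↔̲ (M ⊎ᴷ N , inj₂ s)
↔̲-inj₂ M N s = (λ t t′ → inj₂ t ≡ t′) , record
  { atom  = λ { refl → id , id }
  ; forth = λ { refl r → _ , inj₂ r , refl }
  ; back  = λ { refl (inj₂ r) → _ , r , refl }
  } , refl

↔̲-copy : (M : KripkeModel V) (s : dom M) (i : ℕ) → (M , s) ↔̲ (copies M , (s , i))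
↔̲-copy M s i = (λ t t′ → t ≡ proj₁ t′) , record
  { atom  = λ { refl → id , id }
  ; forth = λ { refl r → _ , (refl , r) , refl }
  ; back  = λ { refl (_ , r) → _ , r , refl }
  } , refl

-- Nodes of the unravelling are words over the domain, latest point first. Words
-- that are not paths are kept: they are unreachable from the root.
module _ (M : KripkeModel V) (s : dom M) where

  endpoint : List (dom M) → dom M
  endpoint []      = s
  endpoint (t ∷ _) = t

  data Child : Rel (List (dom M)) 0ℓ where
    child : ∀ {w u} → R M (endpoint w) u → Child w (u ∷ w)

  unravelling : KripkeModel V
  dom unravelling   = List (dom M)
  R unravelling     = Child
  v unravelling w   = v M (endpoint w)

  ↔̲-unravelling : (M , s) ↔̲ (unravelling , [])
  ↔̲-unravelling = (λ t w → t ≡ endpoint w) , record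
    { atom  = λ { refl → id , id }
    ; forth = λ { refl r → _ , child r , refl }
    ; back  = λ { refl (child r) → _ , r , refl }
    } , refl

  module _ (ℓ : ℕ) (X : Pred V 0ℓ) where

    data TruncatedStep : Rel (Maybe (List (dom M))) 0ℓ where
      child : ∀ {w u} → length w < ℓ → R M (endpoint w) u → TruncatedStep (just w) (just (u ∷ w))
      exit  : ∀ {w} → length w ≡ ℓ → TruncatedStep (just w) nothing
      loop  : TruncatedStep nothing nothing

    -- The unravelling up to depth ℓ, where the only successor of each leaf is the
    -- loopstate nothing with valuation X.
    truncation : KripkeModel V
    dom truncation        = Maybe (List (dom M))
    R truncation          = TruncatedStep
    v truncation (just w) = v M (endpoint w)
    v truncation nothing  = X

    loop-↔̲ : (truncation , nothing) ↔̲ loopstate X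
    loop-↔̲ = (λ t _ → t ≡ nothing) , record
      { atom  = λ { refl → id , id }
      ; forth = λ { refl loop → _ , tt , refl }
      ; back  = λ { refl _ → _ , loop , refl }
      } , refl

    -- The slack is at most the distance to depth `ℓ`, because an undirected step changes the depth
    -- by at most one.
    data Shared : ℕ → Rel ((List (dom M) ⊎ Maybe (List (dom M))) × ℕ) 0ℓ where
      shared : ∀ {i w} → i + length w ≤ ℓ → Shared i (inj₁ w , 0) (inj₂ (just w) , 0)

    shared-iso : LocalIso (unravelling ⊎ᴷ truncation) Shared
    shared-iso = record
      { hom     = record
        { weaken     = λ { (shared le) → shared (<⇒≤ le) }
        ; functional = λ { (shared _) (shared _) refl → refl }
        ; atom       = λ { (shared _) → id }
        -- That the child is shared at slack zero says exactly that its parent lies above depth `ℓ`,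
        -- as `TruncatedStep` demands.
        ; preserves  = λ { (shared _) (shared le) (_ , inj₁ (child r)) → refl , inj₂ (child le r) }
        ; extends    = extends
        }
      ; hom⁻¹   = record
        { weaken     = λ { (shared le) → shared (<⇒≤ le) }
        ; functional = λ { (shared _) (shared _) refl → refl }
        ; atom       = λ { (shared _) → id }
        ; preserves  = λ { (shared _) (shared _) (_ , inj₂ (child _ r)) → refl , inj₁ (child r) }
        ; extends    = extends⁻¹
        }
      ; bound   = 1
      ; bounded = λ { (shared _) → s≤s z≤n , s≤s z≤n }
      }
      where
      P = unravelling ⊎ᴷ truncation

      deeper : ∀ i m → suc i + m ≤ ℓ → i + suc m ≤ ℓ
      deeper i m le = subst (_≤ ℓ) (sym (+-suc i m)) le

      shallower : ∀ i m → suc i + suc m ≤ ℓ → i + m ≤ ℓ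
      shallower i m le = ≤-trans (+-mono-≤ (n≤1+n i) (n≤1+n m)) le

      extends : ∀ {i x y u} → Shared (suc i) x y → Adjacent (copies P) x u → ∃ (Shared i u)
      extends (shared le) (fwd (refl , inj₁ (child _))) = _ , shared (deeper _ _ le)
      extends (shared le) (bwd (refl , inj₁ (child _))) = _ , shared (shallower _ _ le)

      extends⁻¹ : ∀ {i x y u} → Shared (suc i) y x → Adjacent (copies P) x u → ∃[ t ] Shared i t u
      extends⁻¹ (shared le) (fwd (refl , inj₂ (child _ _))) = _ , shared (deeper _ _ le)
      -- A leaf has depth `ℓ`, which leaves no positive slack for the step to the loop.
      extends⁻¹ {i} (shared le) (fwd (refl , inj₂ (exit refl))) =
        contradiction le (m+1+n≰m _ ∘ subst (_≤ ℓ) (+-comm (suc i) _))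
      extends⁻¹ (shared le) (bwd (refl , inj₂ (child _ _))) = _ , shared (shallower _ _ le)

module _ (em : ExcludedMiddle (lsuc 0ℓ)) (α : FO V 1) (preserved : PreservedUnderWeakSimulations α) where

  invariant : {X Y : PointedModel V} → X ↔̲ Y → satisfies α X → satisfies α Y
  invariant bisim = preserved _ _ _ _ (↔̲⇒weaklySimulates bisim)

  module _ (M : KripkeModel V) (s : dom M) (X : Pred V 0ℓ) where

    private
      ℓ = radius α
      T = unravelling M s
      N = truncation M s ℓ X

      matched : Matched (Shared M s ℓ X) ℓ ((inj₁ [] , 0) ∷ []) ((inj₂ (just []) , 0) ∷ [])
      matched zero = shared (≤-reflexive (+-identityʳ ℓ))

    -- `transfer` compares points of a single model, so `α` is carried by bisimulations into the
    -- copies of the disjoint union and out again. The roots are shared with slack `radius α`.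
    locality : satisfies α (M , s) → satisfies α (N , just [])
    locality a =
      invariant (↔̲-sym (↔̲-inj₂ T N (just [])))
        (invariant (↔̲-sym (↔̲-copy (T ⊎ᴷ N) (inj₂ (just [])) 0))
          (transfer em α (shared-iso M s ℓ X) matched
            (invariant (↔̲-copy (T ⊎ᴷ N) (inj₁ []) 0)
              (invariant (↔̲-inj₁ T N [])
                (invariant (↔̲-unravelling M s) a)))))

    locality⁻¹ : satisfies α (N , just []) → satisfies α (M , s)
    locality⁻¹ a =
      invariant (↔̲-sym (↔̲-unravelling M s))
        (invariant (↔̲-sym (↔̲-inj₁ T N []))
          (invariant (↔̲-sym (↔̲-copy (T ⊎ᴷ N) (inj₁ []) 0))
            (transfer em α (inverse (shared-iso M s ℓ X)) matched
              (invariant (↔̲-copy (T ⊎ᴷ N) (inj₂ (just [])) 0)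
                (invariant (↔̲-inj₂ T N (just [])) a)))))

-- The fragment

bisimulation-preserves : {M M′ : KripkeModel V} {Z : REL (dom M) (dom M′) 0ℓ} → IsBisimulation M M′ Z →
                         ∀ {φ} → L□◇∧∨ φ → ∀ {t t′} → Z t t′ → M , t ⊩ φ → M′ , t′ ⊩ φ
bisimulation-preserves B (var p)  z h         = proj₁ (IsBisimulation.atom B z) h
bisimulation-preserves B (l ∧ᵐ m) z (h , k)   =
  bisimulation-preserves B l z h , bisimulation-preserves B m z k
bisimulation-preserves B (l ∨ᵐ m) z (inj₁ h)  = inj₁ (bisimulation-preserves B l z h)
bisimulation-preserves B (l ∨ᵐ m) z (inj₂ h)  = inj₂ (bisimulation-preserves B m z h)
bisimulation-preserves B (□ l) z h u′ r′      =
  let u , r , z′ = IsBisimulation.back B z r′ in bisimulation-preserves B l z′ (h u r)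
bisimulation-preserves B (◇ l) z (u , r , h)  =
  let u′ , r′ , z′ = IsBisimulation.forth B z r in u′ , r′ , bisimulation-preserves B l z′ h

emptyLoopstate-falsifies : {φ : Modal V} → L□◇∧∨ φ → ¬ (proj₁ emptyLoopstate , tt ⊩ φ)
emptyLoopstate-falsifies (var p) h             = h
emptyLoopstate-falsifies (l ∧ᵐ m) (h , _)      = emptyLoopstate-falsifies l h
emptyLoopstate-falsifies (l ∨ᵐ m) (inj₁ h)     = emptyLoopstate-falsifies l h
emptyLoopstate-falsifies (l ∨ᵐ m) (inj₂ h)     = emptyLoopstate-falsifies m h
emptyLoopstate-falsifies (□ l) h               = emptyLoopstate-falsifies l (h tt tt)
emptyLoopstate-falsifies (◇ l) (_ , _ , h)     = emptyLoopstate-falsifies l h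

fullLoopstate-satisfies : {φ : Modal V} → L□◇∧∨ φ → proj₁ fullLoopstate , tt ⊩ φ
fullLoopstate-satisfies (var p)  = tt
fullLoopstate-satisfies (l ∧ᵐ m) = fullLoopstate-satisfies l , fullLoopstate-satisfies m
fullLoopstate-satisfies (l ∨ᵐ m) = inj₁ (fullLoopstate-satisfies l)
fullLoopstate-satisfies (□ l)    = λ _ _ → fullLoopstate-satisfies l
fullLoopstate-satisfies (◇ l)    = tt , tt , fullLoopstate-satisfies l

-- The exempted successors do no harm: one bisimilar to the full loopstate satisfies whatever
-- follows □, and one bisimilar to the empty loopstate cannot witness a ◇.
weakSimulation-preserves : {M M′ : KripkeModel V} {Z : REL (dom M) (dom M′) 0ℓ} → IsWeakSimulation M M′ Z →
                           ∀ {φ} → L□◇∧∨ φ → ∀ {t t′} → Z t t′ → M , t ⊩ φ → M′ , t′ ⊩ φ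
weakSimulation-preserves W (var p)  z h        = IsWeakSimulation.atom W z h
weakSimulation-preserves W (l ∧ᵐ m) z (h , k)  =
  weakSimulation-preserves W l z h , weakSimulation-preserves W m z k
weakSimulation-preserves W (l ∨ᵐ m) z (inj₁ h) = inj₁ (weakSimulation-preserves W l z h)
weakSimulation-preserves W (l ∨ᵐ m) z (inj₂ h) = inj₂ (weakSimulation-preserves W m z h)
weakSimulation-preserves W (□ l) z h u′ r′ with IsWeakSimulation.back′ W z r′
... | inj₁ full with _ , B , z′ ← ↔̲-sym full = bisimulation-preserves B l z′ (fullLoopstate-satisfies l)
... | inj₂ (u , r , z′)     = weakSimulation-preserves W l z′ (h u r)
weakSimulation-preserves W (◇ l) z (u , r , h) with IsWeakSimulation.forth′ W z r
... | inj₁ (_ , B , z′)     = contradiction (bisimulation-preserves B l z′ h) (emptyLoopstate-falsifies l)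
... | inj₂ (u′ , r′ , z′)   = u′ , r′ , weakSimulation-preserves W l z′ h

Fragment : Set → Set
Fragment V = ∃ (L□◇∧∨ {V})

infix 4 _⊩ᶠ_

_⊩ᶠ_ : PointedModel V → Fragment V → Set
(M , s) ⊩ᶠ (φ , _) = M , s ⊩ φ

-- The first formula is separate because the fragment lacks the constants that would be the empty
-- conjunction and disjunction.
⋀ ⋁ : Fragment V → List (Fragment V) → Fragment V
⋀ φ []      = φ
⋀ φ (ψ ∷ Γ) = _ , proj₂ φ ∧ᵐ proj₂ (⋀ ψ Γ)
⋁ φ []      = φ
⋁ φ (ψ ∷ Γ) = _ , proj₂ φ ∨ᵐ proj₂ (⋁ ψ Γ)

⋀-intro : ∀ {X : PointedModel V} {φ} Γ → All (X ⊩ᶠ_) (φ ∷ Γ) → X ⊩ᶠ ⋀ φ Γ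
⋀-intro []      (h ∷ _)  = h
⋀-intro (_ ∷ Γ) (h ∷ hs) = h , ⋀-intro Γ hs

⋀-elim : ∀ {X : PointedModel V} {φ} Γ → X ⊩ᶠ ⋀ φ Γ → All (X ⊩ᶠ_) (φ ∷ Γ)
⋀-elim []      h        = h ∷ []
⋀-elim (_ ∷ Γ) (h , hs) = h ∷ ⋀-elim Γ hs

⋁-intro : ∀ {X : PointedModel V} {φ} Γ → Any (X ⊩ᶠ_) (φ ∷ Γ) → X ⊩ᶠ ⋁ φ Γ
⋁-intro []      (here h)  = h
⋁-intro (_ ∷ Γ) (here h)  = inj₁ h
⋁-intro (_ ∷ Γ) (there a) = inj₂ (⋁-intro Γ a)

⋁-elim : ∀ {X : PointedModel V} {φ} Γ → X ⊩ᶠ ⋁ φ Γ → Any (X ⊩ᶠ_) (φ ∷ Γ)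
⋁-elim []      h        = here h
⋁-elim (_ ∷ Γ) (inj₁ h) = here h
⋁-elim (_ ∷ Γ) (inj₂ h) = there (⋁-elim Γ h)

-- Constants may occur only as the whole formula, so a constant remainder is absorbed instead of
-- being joined by ∨.
disjunctiveNormalForm : (Δ : List (List (Fragment V))) →
  ∃[ φ ] L□◇∧∨∪⊤⊥ φ × (∀ M s → M , s ⊩ φ ⇔ Any (All ((M , s) ⊩ᶠ_)) Δ)
disjunctiveNormalForm []             = ⊥ᵐ , inj₂ (inj₂ refl) , λ M s → mk⇔ (λ ()) (λ ())
disjunctiveNormalForm ([] ∷ Δ)       =
  ⊤ᵐ , inj₂ (inj₁ refl) , λ M s → mk⇔ (λ _ → here []) (λ _ → tt)
disjunctiveNormalForm ((φ ∷ Γ) ∷ Δ) with disjunctiveNormalForm Δ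
... | χ , inj₁ l , χ⇔ = _ , inj₁ (proj₂ (⋀ φ Γ) ∨ᵐ l) , λ M s → mk⇔
  (λ { (inj₁ h) → here (⋀-elim Γ h) ; (inj₂ h) → there (Equivalence.to (χ⇔ M s) h) })
  (λ { (here hs) → inj₁ (⋀-intro Γ hs) ; (there a) → inj₂ (Equivalence.from (χ⇔ M s) a) })
... | _ , inj₂ (inj₁ refl) , χ⇔ =
  ⊤ᵐ , inj₂ (inj₁ refl) , λ M s → mk⇔ (λ _ → there (Equivalence.to (χ⇔ M s) tt)) (λ _ → tt)
... | _ , inj₂ (inj₂ refl) , χ⇔ = _ , inj₁ (proj₂ (⋀ φ Γ)) , λ M s → mk⇔
  (λ h → here (⋀-elim Γ h))
  (λ { (here hs) → ⋀-intro Γ hs ; (there a) → ⊥-elim (Equivalence.from (χ⇔ M s) a) })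

-- Characteristic formulas of bounded depth

sublists : ∀ {a} {A : Set a} → List A → List (List A)
sublists []       = [] ∷ []
sublists (x ∷ xs) = map (x ∷_) (sublists xs) ++ sublists xs

-- A classical filter, level polymorphic because it is applied both to formulas true at a point and
-- to sets of formulas realised in some model.
select : ∀ {a p} {A : Set a} → ExcludedMiddle p → (P : Pred A p) (xs : List A) →
         ∃[ ys ] ys ∈ sublists xs × All P ys × (∀ {x} → x ∈ xs → P x → x ∈ ys)
select em P [] = [] , here refl , [] , λ ()
select em P (x ∷ xs) with em {P x} | select em P xs
... | yes px | ys , ys∈ , all , complete = x ∷ ys , ∈-++⁺ˡ (∈-map⁺ (x ∷_) ys∈) , px ∷ all , λ where
  (here refl) _  → here refl
  (there x∈)  py → there (complete x∈ py)
... | no ¬px | ys , ys∈ , all , complete = ys , ∈-++⁺ʳ _ ys∈ , all , λ where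
  (here refl) px → contradiction px ¬px
  (there x∈)  py → complete x∈ py

-- These are the shapes of the characteristic formulas below. The empty list would give `◇ ⊤ᵐ` and
-- `□ ⊥ᵐ`, which lie outside the fragment.
modalities : List (Fragment V) → List (Fragment V)
modalities []      = []
modalities (φ ∷ Γ) = (_ , ◇ proj₂ (⋀ φ Γ)) ∷ (_ , □ proj₂ (⋁ φ Γ)) ∷ []

module _ (vars : List V) where

  -- Up to equivalence, every formula of the fragment of modal depth at most i is a
  -- positive Boolean combination of these.
  formulas : ℕ → List (Fragment V)
  formulas zero    = map (λ p → _ , var p) vars
  formulas (suc i) = map (λ p → _ , var p) vars ++ concatMap modalities (sublists (formulas i))

  var∈formulas : ∀ i {p} → p ∈ vars → (_ , var p) ∈ formulas i
  var∈formulas zero    p∈ = ∈-map⁺ _ p∈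
  var∈formulas (suc i) p∈ = ∈-++⁺ˡ (∈-map⁺ _ p∈)

  modality∈formulas : ∀ i {Γ φ} → Γ ∈ sublists (formulas i) → φ ∈ modalities Γ → φ ∈ formulas (suc i)
  modality∈formulas i Γ∈ φ∈ = ∈-++⁺ʳ _ (∈-concatMap⁺ modalities (lose Γ∈ φ∈))

  _⇛⟨_⟩_ : PointedModel V → ℕ → PointedModel V → Set
  X ⇛⟨ i ⟩ Y = ∀ φ → φ ∈ formulas i → X ⊩ᶠ φ → Y ⊩ᶠ φ

  Falsifies Satisfies : ℕ → PointedModel V → Set
  Falsifies i X = ∀ φ → φ ∈ formulas i → ¬ X ⊩ᶠ φ
  Satisfies i X = ∀ φ → φ ∈ formulas i → X ⊩ᶠ φ

  module _ (em : ExcludedMiddle (lsuc 0ℓ)) where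

    ¬falsifies : ∀ i X → ¬ Falsifies i X → ∃[ φ ] φ ∈ formulas i × X ⊩ᶠ φ
    ¬falsifies i X ¬h = decidable-stable (em₀ em) λ ¬ex → ¬h λ _ φ∈ h → ¬ex (_ , φ∈ , h)

    ¬satisfies : ∀ i X → ¬ Satisfies i X → ∃[ φ ] φ ∈ formulas i × ¬ X ⊩ᶠ φ
    ¬satisfies i X ¬h = decidable-stable (em₀ em) λ ¬ex → ¬h λ _ φ∈ →
      decidable-stable (em₀ em) λ ¬sat → ¬ex (_ , φ∈ , ¬sat)

    -- `χ` is the conjunction of all formulas of level `i` true at `X`; the given `φ` makes it
    -- nonempty.
    characteristic-◇ : ∀ i X {φ} → φ ∈ formulas i → X ⊩ᶠ φ →
      ∃[ χ ] (_ , ◇ proj₂ χ) ∈ formulas (suc i) × X ⊩ᶠ χ × (∀ {Y} → Y ⊩ᶠ χ → X ⇛⟨ i ⟩ Y)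
    characteristic-◇ i X φ∈ h with select (em₀ em) (X ⊩ᶠ_) (formulas i)
    ... | [] , _ , _ , complete = contradiction (complete φ∈ h) λ ()
    ... | ψ ∷ Γ , Γ∈ , all , complete =
      ⋀ ψ Γ , modality∈formulas i Γ∈ (here refl) , ⋀-intro Γ all ,
      λ hY _ φ∈ hX → All.lookup (⋀-elim Γ hY) (complete φ∈ hX)

    -- Dually, `χ` is the disjunction of all formulas of level `i` false at `Y`, so a point
    -- falsifying it satisfies only formulas true at `Y`.
    characteristic-□ : ∀ i Y {φ} → φ ∈ formulas i → ¬ Y ⊩ᶠ φ →
      ∃[ χ ] (_ , □ proj₂ χ) ∈ formulas (suc i) × ¬ Y ⊩ᶠ χ × (∀ {X} → ¬ X ⊩ᶠ χ → X ⇛⟨ i ⟩ Y)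
    characteristic-□ i Y φ∈ ¬h with select (em₀ em) (λ φ → ¬ Y ⊩ᶠ φ) (formulas i)
    ... | [] , _ , _ , complete = contradiction (complete φ∈ ¬h) λ ()
    ... | ψ ∷ Γ , Γ∈ , all , complete =
      ⋁ ψ Γ , modality∈formulas i Γ∈ (there (here refl)) ,
      (λ h → let ¬hψ , hψ = All.lookupAny all (⋁-elim Γ h) in ¬hψ hψ) ,
      λ ¬hX _ φ∈ hX → decidable-stable (em₀ em) λ ¬hY → ¬hX (⋁-intro Γ (lose (complete φ∈ ¬hY) hX))

    module _ {M M′ : KripkeModel V} i {t t′} (t⇛t′ : (M , t) ⇛⟨ suc i ⟩ (M′ , t′)) where

      -- If some formula of level `i` holds at `u`, then ◇ of its characteristic formula holds at
      -- `t`, hence at `t′`, and the witness there is `u′`.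
      ⇛-forth : ∀ {u} → R M t u → Falsifies i (M , u) ⊎ (∃[ u′ ] R M′ t′ u′ × (M , u) ⇛⟨ i ⟩ (M′ , u′))
      ⇛-forth {u} r with em₀ em {Falsifies i (M , u)}
      ... | yes false = inj₁ false
      ... | no ¬false =
        let _ , φ∈ , h = ¬falsifies i (M , u) ¬false
            χ , ◇χ∈ , hχ , char = characteristic-◇ i (M , u) φ∈ h
            u′ , r′ , h′ = t⇛t′ _ ◇χ∈ (u , r , hχ)
        in inj₂ (u′ , r′ , char {M′ , u′} h′)

      ⇛-back : ∀ {u′} → R M′ t′ u′ → Satisfies i (M′ , u′) ⊎ (∃[ u ] R M t u × (M , u) ⇛⟨ i ⟩ (M′ , u′))
      ⇛-back {u′} r′ with em₀ em {Satisfies i (M′ , u′)}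
      ... | yes true = inj₁ true
      ... | no ¬true =
        let _ , φ∈ , ¬h = ¬satisfies i (M′ , u′) ¬true
            χ , □χ∈ , ¬hχ , char = characteristic-□ i (M′ , u′) φ∈ ¬h
        in inj₂ (decidable-stable (em₀ em) λ ¬ex → ¬hχ (t⇛t′ _ □χ∈ (λ u r →
             decidable-stable (em₀ em) λ ¬hu → ¬ex (u , r , char {M , u} ¬hu)) u′ r′))

-- Weak simulation between truncations

module _ (M : KripkeModel V) (s : dom M) (ℓ : ℕ) (X : Pred V 0ℓ) (K : ℕ → dom M → Set)
  (atom       : ∀ {i t} → K i t → v M t ≐ X)
  (successor  : ∀ {i t} → K (suc i) t → ∃ (R M t))
  (hereditary : ∀ {i t u} → K (suc i) t → R M t u → K i u) where

  data Collapsed : REL (Maybe (List (dom M))) ⊤ 0ℓ where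
    node : ∀ {i w} → i + length w ≡ ℓ → K i (endpoint M s w) → Collapsed (just w) tt
    loop : Collapsed nothing tt

  -- `K i` stands for falsifying, or satisfying, all of level `i`. While `i` is positive it provides
  -- a successor and passes to all of them; at zero the node is a leaf and moves to the loop.
  collapse : ∀ {i w} → i + length w ≡ ℓ → K i (endpoint M s w) →
             (truncation M s ℓ X , just w) ↔̲ loopstate X
  collapse e k = Collapsed , record
    { atom  = λ { (node _ k) → atom k ; loop → id , id }
    ; forth = forth
    ; back  = λ z _ → back z
    } , node e k
    where
    forth : ∀ {t t′ u} → Collapsed t t′ → TruncatedStep M s ℓ X t u → ∃[ u′ ] ⊤ × Collapsed u u′
    forth (node {zero}  e k) (child lt r) = contradiction (≤-reflexive (sym e)) (<⇒≱ lt)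
    forth (node {suc i} e k) (child lt r) = tt , tt , node (trans (+-suc i _) e) (hereditary k r)
    forth (node _ _)         (exit _)     = tt , tt , loop
    forth loop               loop         = tt , tt , loop

    back : ∀ {t t′ u′} → Collapsed t t′ → ∃[ u ] TruncatedStep M s ℓ X t u × Collapsed u u′
    back (node {zero}  e k) = _ , exit e , loop
    back (node {suc i} e k) =
      let _ , r = successor k
      in _ , child (≤-trans (s≤s (m≤n+m _ i)) (≤-reflexive e)) r , node (trans (+-suc i _) e) (hereditary k r)
    back loop = _ , loop , loop

module _ (em : ExcludedMiddle (lsuc 0ℓ)) (vars : List V) (complete : ∀ p → p ∈ vars) (p₀ : V)
         (M M′ : KripkeModel V) (s : dom M) (s′ : dom M′) (ℓ : ℕ) where

  private
    N  = truncation M s ℓ ∅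
    N′ = truncation M′ s′ ℓ U

    infix 4 _⇛⟨_⟩′_
    _⇛⟨_⟩′_ : PointedModel V → ℕ → PointedModel V → Set
    _⇛⟨_⟩′_ = _⇛⟨_⟩_ vars

  falsifies⇒empty : ∀ {i w} → i + length w ≡ ℓ → Falsifies vars i (M , endpoint M s w) →
                    (N , just w) ↔̲ emptyLoopstate
  falsifies⇒empty = collapse M s ℓ ∅ (λ i t → Falsifies vars i (M , t))
    (λ {i} f → (λ {p} → f _ (var∈formulas vars i (complete p))) , λ ())
    (λ {i} f →
      -- The call serves to produce some formula `□ χ` of the level, which would be true at a point
      -- without successors. Here `p₀` supplies a formula false at the empty loopstate.
      let _ , □χ∈ , _ = characteristic-□ vars em i emptyLoopstate (var∈formulas vars i (complete p₀)) id
      in decidable-stable (em₀ em) λ ¬ex → f _ □χ∈ λ u r → ⊥-elim (¬ex (u , r)))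
    (λ {i} {_} {u} f r _ φ∈ h →
      let _ , ◇χ∈ , hχ , _ = characteristic-◇ vars em i (M , u) φ∈ h in f _ ◇χ∈ (u , r , hχ))

  satisfies⇒full : ∀ {i w} → i + length w ≡ ℓ → Satisfies vars i (M′ , endpoint M′ s′ w) →
                   (N′ , just w) ↔̲ fullLoopstate
  satisfies⇒full = collapse M′ s′ ℓ U (λ i t → Satisfies vars i (M′ , t))
    (λ {i} f → (λ _ → tt) , λ {p} _ → f _ (var∈formulas vars i (complete p)))
    (λ {i} f →
      -- Any `◇ χ` of the level yields a successor once it is satisfied.
      let _ , ◇χ∈ , _ = characteristic-◇ vars em i fullLoopstate (var∈formulas vars i (complete p₀)) tt
          u , r , _ = f _ ◇χ∈
      in u , r)
    (λ {i} {_} {u} f r _ φ∈ → decidable-stable (em₀ em) λ ¬h →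
      let _ , □χ∈ , ¬hχ , _ = characteristic-□ vars em i (M′ , u) φ∈ ¬h in ¬hχ (f _ □χ∈ u r))

  -- One index `i` serves both words, so both sides reach their leaves together.
  data Simulated : REL (dom N) (dom N′) 0ℓ where
    node : ∀ {i w w′} → i + length w ≡ ℓ → i + length w′ ≡ ℓ →
           (M , endpoint M s w) ⇛⟨ i ⟩′ (M′ , endpoint M′ s′ w′) → Simulated (just w) (just w′)

  truncation-weaklySimulates : (M , s) ⇛⟨ ℓ ⟩′ (M′ , s′) → WeaklySimulates (N , just []) (N′ , just [])
  truncation-weaklySimulates s⇛s′ = Simulated , record
    { atom   = λ { (node {i} _ _ le) {p} → le _ (var∈formulas vars i (complete p)) }
    ; forth′ = forth
    ; back′  = back
    } , node (+-identityʳ ℓ) (+-identityʳ ℓ) s⇛s′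
    where
    below : ∀ i {m} → suc i + m ≡ ℓ → m < ℓ
    below i e = ≤-trans (s≤s (m≤n+m _ i)) (≤-reflexive e)

    forth : ∀ {t t′ u} → Simulated t t′ → R N t u →
            (N , u) ↔̲ emptyLoopstate ⊎ (∃[ u′ ] R N′ t′ u′ × Simulated u u′)
    -- The loop below a leaf is exempt, so a leaf owes no matching successor.
    forth (node _ _ _) (exit _) = inj₁ (loop-↔̲ M s ℓ ∅)
    forth (node {zero} e _ _) (child lt _) = contradiction (≤-reflexive (sym e)) (<⇒≱ lt)
    forth (node {suc i} e e′ le) (child _ r) with ⇛-forth vars em i le r
    ... | inj₁ false = inj₁ (falsifies⇒empty (trans (+-suc i _) e) false)
    ... | inj₂ (u′ , r′ , le′) =
      inj₂ (_ , child (below i e′) r′ , node (trans (+-suc i _) e) (trans (+-suc i _) e′) le′)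

    back : ∀ {t t′ u′} → Simulated t t′ → R N′ t′ u′ →
           (N′ , u′) ↔̲ fullLoopstate ⊎ (∃[ u ] R N t u × Simulated u u′)
    back (node _ _ _) (exit _) = inj₁ (loop-↔̲ M′ s′ ℓ U)
    back (node {zero} _ e′ _) (child lt _) = contradiction (≤-reflexive (sym e′)) (<⇒≱ lt)
    back (node {suc i} e e′ le) (child _ r′) with ⇛-back vars em i le r′
    ... | inj₁ true = inj₁ (satisfies⇒full (trans (+-suc i _) e′) true)
    ... | inj₂ (u , r , le′) =
      inj₂ (_ , child (below i e) r , node (trans (+-suc i _) e) (trans (+-suc i _) e′) le′)

-- Empty `Prop`

loopstates-↔̲ : ¬ V → (A B : Pred V 0ℓ) → loopstate A ↔̲ loopstate B
loopstates-↔̲ ¬V A B = (λ _ _ → ⊤) , record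
  { atom  = λ _ → (λ {p} _ → ⊥-elim (¬V p)) , λ {p} _ → ⊥-elim (¬V p)
  ; forth = λ _ _ → tt , tt , tt
  ; back  = λ _ _ → tt , tt , tt
  } , tt

-- The loop answers every move of `X`; its own move is exempt, since without variables the empty
-- loopstate is also the full one.
simulated-by-loop : ¬ V → (X : PointedModel V) → WeaklySimulates X emptyLoopstate
simulated-by-loop ¬V X = (λ _ _ → ⊤) , record
  { atom   = λ _ {p} _ → ¬V p
  ; forth′ = λ _ _ → inj₂ (tt , tt , tt)
  ; back′  = λ _ _ → inj₁ (loopstates-↔̲ ¬V ∅ U)
  } , tt

simulates-loop : ¬ V → (X : PointedModel V) → WeaklySimulates emptyLoopstate X
simulates-loop ¬V X = (λ _ _ → ⊤) , record
  { atom   = λ _ {p} _ → ⊥-elim (¬V p)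
  ; forth′ = λ _ _ → inj₁ (loopstates-↔̲ ¬V ∅ ∅)
  ; back′  = λ _ _ → inj₂ (tt , tt , tt)
  } , tt

-- Definability and preservation

module _ (em : ExcludedMiddle (lsuc 0ℓ)) (vars : List V) (complete : ∀ p → p ∈ vars)
         (α : FO V 1) (preserved : PreservedUnderWeakSimulations α) where

  private
    Φ = formulas vars (radius α)

  -- `α` passes from `M` to its truncation over empty loopstates, along the weak simulation, and
  -- back from the truncation of `M′` over full ones.
  ⇛-preserves : ∀ {X Y} → _⇛⟨_⟩_ vars X (radius α) Y → satisfies α X → satisfies α Y
  ⇛-preserves {X@(M , s)} {Y@(M′ , s′)} X⇛Y a with em₀ em {V}
  ... | yes p = locality⁻¹ em α preserved M′ s′ U
    (preserved _ _ _ _ (truncation-weaklySimulates em vars complete p M M′ s s′ (radius α) X⇛Y)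
      (locality em α preserved M s ∅ a))
  ... | no ¬V = preserved _ _ _ _ (simulates-loop ¬V Y) (preserved _ _ _ _ (simulated-by-loop ¬V X) a)

  definable : ∃[ φ ] L□◇∧∨∪⊤⊥ φ × α ≡ᶠ ST zero φ
  -- `Γ` has to contain the type of some `X` satisfying `α`. Any point satisfying all of `Γ` then
  -- satisfies every formula of `Φ` true at `X`, hence `α`. The quantifier over models accounts for
  -- the level of `em`.
  definable with select em (λ Γ → ∃[ X ] satisfies α X × (∀ φ → φ ∈ Φ → X ⊩ᶠ φ → φ ∈ Γ)) (sublists Φ)
  ... | Δ , _ , realised , exhaustive with disjunctiveNormalForm Δ
  ...   | φ , l , φ⇔ = φ , l , λ where
    M ρ@(s ∷ []) → mk⇔
      (λ a → let Γ , Γ∈ , all , complete = select (em₀ em) ((M , s) ⊩ᶠ_) Φ in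
        Equivalence.to (ST-correct M ρ zero φ) (Equivalence.from (φ⇔ M s)
          (lose (exhaustive Γ∈ ((M , s) , a , λ _ → complete)) all)))
      (λ h → let Γ , Γ∈ , all = find (Equivalence.to (φ⇔ M s) (Equivalence.from (ST-correct M ρ zero φ) h))
                 X , a , types = All.lookup realised Γ∈
             in ⇛-preserves (λ _ φ∈ hX → All.lookup all (types _ φ∈ hX)) a)

fragment-preserved : {φ : Modal V} → L□◇∧∨∪⊤⊥ φ → PreservedUnderWeakSimulations (ST zero φ)
fragment-preserved (inj₂ (inj₁ refl)) M M′ s s′ _ h = h
fragment-preserved (inj₂ (inj₂ refl)) M M′ s s′ _ h = h
fragment-preserved {φ = φ} (inj₁ l) M M′ s s′ (Z , W , z) h =
  Equivalence.to (ST-correct M′ (s′ ∷ []) zero φ)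
    (weakSimulation-preserves W l z (Equivalence.from (ST-correct M (s ∷ []) zero φ) h))

theorem4p10 : ExcludedMiddle (lsuc 0ℓ) →
    (V : Set) (n : ℕ) → V ↔ Fin n →
    (α : FO V 1) →
    PreservedUnderWeakSimulations α ⇔ (∃[ φ ] L□◇∧∨∪⊤⊥ φ × α ≡ᶠ ST zero φ)
theorem4p10 em V n V↔Fin α = mk⇔
  (definable em (map from (allFin n)) complete α)
  (λ (φ , l , α≡φ) M M′ s s′ sim a →
    Equivalence.from (α≡φ M′ (s′ ∷ []))
      (fragment-preserved l M M′ s s′ sim (Equivalence.to (α≡φ M (s ∷ [])) a)))
  where
  open Inverse V↔Fin using (to; from; strictlyInverseʳ)

  complete : ∀ p → p ∈ map from (allFin n)
  complete p = subst (_∈ map from (allFin n)) (strictlyInverseʳ p) (∈-map⁺ from (∈-allFin (to p)))
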